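{- Let $M$ be a large positive parameter and let $\mathcal{X}$ be any subset of $\{1,2,\ldots,10^M\}$. For a large positive parameter $N$, let $\mathcal{J}(N)$ denote the number of solutions $(x,y,p)$ of $$x\equiv y \pmod p;\qquad x,y\in\mathcal{X},\quad p\le N,\ p \text{ prime}.$$ Then $$\mathcal{J}(N)=\pi(N)\,|\mathcal{X}|+O\!\left(\frac{|\mathcal{X}|^2 M}{\log M}\right),$$ where the implied constant is absolute.
   Context: $\pi(N)$ denotes the number of primes $p\le N$. -}

module Defs where

import Algebra.Definitions.RawSemiring
open import Data.Fin.Base using (Fin; toℕ)
open import Data.Fin.Subset using (Subset; _∈_)
open import Data.Fin.Subset.Properties using (_∈?_)
open import Data.Integer.Base as ℤ using (+_)
import Data.Integer.Properties as ℤₚ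
open import Data.List.Base using (length; filter; upTo; allFin; cartesianProduct)
open import Data.Nat.Base as ℕ using (ℕ; zero; suc; NonZero)
open import Data.Nat.Divisibility using (_∣_; _∣?_)
open import Data.Nat.Primality using (Prime; prime?)
import Data.Nat.Properties as ℕₚ
open import Data.Product.Base using (_×_; _,_; ∃)
open import Data.Rational.Base using (ℚ; _/_; _+_; _-_; _*_; -_; ∣_∣; _≤_; 0ℚ; 1ℚ; nonNegative; +-*-rawSemiring)
open import Data.Rational.Properties as ℚₚ using ()
open import Data.Rational.Solver using (module +-*-Solver)
open import Data.Rational.Unnormalised.Base as ℚᵘ using (mkℚᵘ)
import Data.Rational.Unnormalised.Properties as ℚᵘₚ
open import Data.Sum.Base using (inj₁; inj₂)
open import Relation.Binary.PropositionalEquality using (_≡_; refl; sym; trans; cong; cong₂; subst; subst₂)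
open import Relation.Nullary.Decidable using (Dec; _×-dec_)

open Algebra.Definitions.RawSemiring +-*-rawSemiring using (_^_)

infix 4 _≤ᴿ_ _≡_[mod_]
infixr 7 _·_

-- The standard library has no real numbers.  A real is a Cauchy sequence of
-- rationals, with precisions 1/(k+1) in place of arbitrary ε > 0.
record ℝ : Set where
  constructor mkℝ
  field
    seq    : ℕ → ℚ
    cauchy : ∀ k → ∃ λ K → ∀ m n → K ℕ.≤ m → K ℕ.≤ n →
             ∣ seq m - seq n ∣ ≤ + 1 / suc k

open ℝ public

_≤ᴿ_ : ℝ → ℝ → Set
x ≤ᴿ y = ∀ k → ∃ λ K → ∀ n → K ℕ.≤ n → seq x n ≤ seq y n + + 1 / suc k

private
  /-mono : ∀ a b c d → a ℕ.* suc d ℕ.≤ c ℕ.* suc b → + a / suc b ≤ + c / suc d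
  /-mono a b c d h = ℚₚ.toℚᵘ-cancel-≤
    (ℚᵘₚ.≤-respˡ-≃ (ℚᵘₚ.≃-sym (ℚₚ.toℚᵘ-fromℚᵘ (mkℚᵘ (+ a) b)))
    (ℚᵘₚ.≤-respʳ-≃ (ℚᵘₚ.≃-sym (ℚₚ.toℚᵘ-fromℚᵘ (mkℚᵘ (+ c) d)))
    (ℚᵘ.*≤* (subst₂ ℤ._≤_ (ℤₚ.pos-* a (suc d)) (ℤₚ.pos-* c (suc b)) (ℤ.+≤+ h)))))

  /-*-/ : ∀ a b c → (+ a / 1) * (+ c / suc b) ≡ + (a ℕ.* c) / suc b
  /-*-/ a b c = ℚₚ.toℚᵘ-injective
    (ℚᵘₚ.≃-trans (ℚₚ.toℚᵘ-homo-* (+ a / 1) (+ c / suc b))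
    (ℚᵘₚ.≃-trans (ℚᵘₚ.*-cong (ℚₚ.toℚᵘ-fromℚᵘ (mkℚᵘ (+ a) 0)) (ℚₚ.toℚᵘ-fromℚᵘ (mkℚᵘ (+ c) b)))
    (ℚᵘₚ.≃-trans (ℚᵘ.*≡* (cong₂ ℤ._*_ (sym (ℤₚ.pos-* a c)) (cong +_ (sym (ℕₚ.+-identityʳ (suc b))))))
    (ℚᵘₚ.≃-sym (ℚₚ.toℚᵘ-fromℚᵘ (mkℚᵘ (+ (a ℕ.* c)) b))))))

  0≤/ : ∀ a b → 0ℚ ≤ + a / suc b
  0≤/ a b = ℚₚ.nonNegative⁻¹ (+ a / suc b) {{ℚₚ.normalize-nonNeg a (suc b)}}

  *-nonNeg : ∀ {p q} → 0ℚ ≤ p → 0ℚ ≤ q → 0ℚ ≤ p * q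
  *-nonNeg {p} {q} 0≤p 0≤q = ℚₚ.nonNegative⁻¹ (p * q)
    {{ℚₚ.nonNeg*nonNeg⇒nonNeg p {{nonNegative 0≤p}} q {{nonNegative 0≤q}}}}

  ≤⇒0≤- : ∀ {p q} → p ≤ q → 0ℚ ≤ q - p
  ≤⇒0≤- {p} {q} p≤q = subst (_≤ q - p) (ℚₚ.+-inverseʳ p) (ℚₚ.+-monoˡ-≤ (- p) p≤q)

fromℕ : ℕ → ℝ
fromℕ a .seq    _ = + a / 1
fromℕ a .cauchy k = 0 , λ _ _ _ _ →
  subst (_≤ + 1 / suc k) (sym (cong ∣_∣ (ℚₚ.+-inverseʳ (+ a / 1)))) (0≤/ 1 k)

_·_ : ℕ → ℝ → ℝ
(a · x) .seq    n = + a / 1 * seq x n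
(a · x) .cauchy k with cauchy x (k ℕ.+ a ℕ.* suc k)
... | K , close = K , λ m n K≤m K≤n → begin
  ∣ q * seq x m - q * seq x n ∣      ≡⟨ cong ∣_∣ (factor q (seq x m) (seq x n)) ⟩
  ∣ q * (seq x m - seq x n) ∣        ≡⟨ ℚₚ.∣p*q∣≡∣p∣*∣q∣ q (seq x m - seq x n) ⟩
  ∣ q ∣ * ∣ seq x m - seq x n ∣      ≡⟨ cong (_* ∣ seq x m - seq x n ∣) (ℚₚ.0≤p⇒∣p∣≡p (0≤/ a 0)) ⟩
  q * ∣ seq x m - seq x n ∣          ≤⟨ ℚₚ.*-monoˡ-≤-nonNeg q {{nonNegative (0≤/ a 0)}} (close m n K≤m K≤n) ⟩
  q * (+ 1 / suc k′)                 ≡⟨ /-*-/ a k′ 1 ⟩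
  + (a ℕ.* 1) / suc k′               ≤⟨ /-mono (a ℕ.* 1) k′ 1 k bound ⟩
  + 1 / suc k                        ∎
  where
  open ℚₚ.≤-Reasoning
  q  = + a / 1
  k′ = k ℕ.+ a ℕ.* suc k
  factor : ∀ q s t → q * s - q * t ≡ q * (s - t)
  factor = solve 3 (λ q s t → q :* s :- q :* t := q :* (s :- t)) refl
    where open +-*-Solver
  bound : a ℕ.* 1 ℕ.* suc k ℕ.≤ 1 ℕ.* suc k′
  bound = subst₂ ℕ._≤_ (cong (ℕ._* suc k) (sym (ℕₚ.*-identityʳ a))) (sym (ℕₚ.*-identityˡ (suc k′)))
    (ℕₚ.m≤n+m (a ℕ.* suc k) (suc k))

∑< : ℕ → (ℕ → ℚ) → ℚ
∑< zero    f = 0ℚ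
∑< (suc n) f = ∑< n f + f n

-- Partial sums of Mercator's series  log n = - log (1 - z) = ∑_{k ≥ 1} zᵏ / k
-- for the natural logarithm, at z = 1 - 1/n ∈ [0,1).
logSeq : (n : ℕ) .{{_ : NonZero n}} → ℕ → ℚ
logSeq n m = ∑< m λ k → (1ℚ - + 1 / n) ^ suc k * (+ 1 / suc k)

private
  module LogCauchy (n-1 : ℕ) where
    open ℚₚ.≤-Reasoning

    n = suc n-1
    z = 1ℚ - + 1 / n
    N = + n / 1
    S = logSeq n

    0≤z : 0ℚ ≤ z
    0≤z = ≤⇒0≤- (/-mono 1 n-1 1 0 (ℕ.s≤s ℕ.z≤n))

    z≤1 : z ≤ 1ℚ
    z≤1 = subst₂ _≤_ (ℚₚ.+-identityʳ z) (cancel 1ℚ (+ 1 / n)) (ℚₚ.+-monoʳ-≤ z (0≤/ 1 n-1))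
      where
      cancel : ∀ p q → (p - q) + q ≡ p
      cancel = solve 2 (λ p q → (p :- q) :+ q := p) refl
        where open +-*-Solver

    0≤z^ : ∀ k → 0ℚ ≤ z ^ k
    0≤z^ zero    = 0≤/ 1 0
    0≤z^ (suc k) = *-nonNeg 0≤z (0≤z^ k)

    z^≤1 : ∀ k → z ^ k ≤ 1ℚ
    z^≤1 zero    = ℚₚ.≤-refl
    z^≤1 (suc k) = begin
      z * z ^ k  ≤⟨ ℚₚ.*-monoˡ-≤-nonNeg z {{nonNegative 0≤z}} (z^≤1 k) ⟩
      z * 1ℚ     ≡⟨ ℚₚ.*-identityʳ z ⟩
      z          ≤⟨ z≤1 ⟩
      1ℚ         ∎

    N/N : N * (+ 1 / n) ≡ 1ℚ
    N/N = trans (/-*-/ n n-1 1) (ℚₚ.≤-antisym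
      (/-mono (n ℕ.* 1) n-1 1 0 (ℕₚ.≤-reflexive eq))
      (/-mono 1 0 (n ℕ.* 1) n-1 (ℕₚ.≤-reflexive (sym eq))))
      where
      eq : n ℕ.* 1 ℕ.* 1 ≡ 1 ℕ.* n
      eq = trans (ℕₚ.*-identityʳ (n ℕ.* 1)) (ℕₚ.*-comm n 1)

    telescope : ∀ c t → t * c + c * (N * (z * t)) ≡ c * (N * t)
    telescope c t = trans (expand c t N (+ 1 / n))
      (trans (cong (λ u → t * c + c * (N * t - u * t)) N/N) (collapse c t N))
      where
      open +-*-Solver
      expand : ∀ c t N i → t * c + c * (N * ((1ℚ - i) * t)) ≡ t * c + c * (N * t - (N * i) * t)
      expand = solve 4 (λ c t N i → t :* c :+ c :* (N :* ((con 1ℚ :- i) :* t))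
                                 := t :* c :+ c :* (N :* t :- (N :* i) :* t)) refl
      collapse : ∀ c t N → t * c + c * (N * t - 1ℚ * t) ≡ c * (N * t)
      collapse = solve 3 (λ c t N → t :* c :+ c :* (N :* t :- con 1ℚ :* t) := c :* (N :* t)) refl

    potential : ∀ m d → let c = + 1 / suc m in
      S (d ℕ.+ m) + c * (N * z ^ suc (d ℕ.+ m)) ≤ S m + c * (N * z ^ suc m)
    potential m zero    = ℚₚ.≤-refl
    potential m (suc d) = begin
      (S j + t * (+ 1 / suc j)) + c * (N * (z * t))
        ≤⟨ ℚₚ.+-monoˡ-≤ (c * (N * (z * t))) (ℚₚ.+-monoʳ-≤ (S j)
             (ℚₚ.*-monoˡ-≤-nonNeg t {{nonNegative (0≤z^ (suc j))}}
               (/-mono 1 j 1 m (ℕₚ.*-monoʳ-≤ 1 (ℕ.s≤s (ℕₚ.m≤n+m m d)))))) ⟩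
      (S j + t * c) + c * (N * (z * t))
        ≡⟨ ℚₚ.+-assoc (S j) (t * c) (c * (N * (z * t))) ⟩
      S j + (t * c + c * (N * (z * t)))
        ≡⟨ cong (λ u → S j + u) (telescope c t) ⟩
      S j + c * (N * t)
        ≤⟨ potential m d ⟩
      S m + c * (N * z ^ suc m) ∎
      where
      j = d ℕ.+ m
      c = + 1 / suc m
      t = z ^ suc j

    upper : ∀ m d → S (d ℕ.+ m) ≤ S m + + n / suc m
    upper m d = begin
      S (d ℕ.+ m)
        ≡⟨ ℚₚ.+-identityʳ (S (d ℕ.+ m)) ⟨
      S (d ℕ.+ m) + 0ℚ
        ≤⟨ ℚₚ.+-monoʳ-≤ (S (d ℕ.+ m)) (*-nonNeg (0≤/ 1 m) (*-nonNeg (0≤/ n 0) (0≤z^ (suc (d ℕ.+ m))))) ⟩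
      S (d ℕ.+ m) + c * (N * z ^ suc (d ℕ.+ m))
        ≤⟨ potential m d ⟩
      S m + c * (N * z ^ suc m)
        ≤⟨ ℚₚ.+-monoʳ-≤ (S m) (ℚₚ.*-monoˡ-≤-nonNeg c {{nonNegative (0≤/ 1 m)}}
             (ℚₚ.*-monoˡ-≤-nonNeg N {{nonNegative (0≤/ n 0)}} (z^≤1 (suc m)))) ⟩
      S m + c * (N * 1ℚ)
        ≡⟨ cong (λ u → S m + u) (trans (cong (c *_) (ℚₚ.*-identityʳ N)) (ℚₚ.*-comm c N)) ⟩
      S m + N * c
        ≡⟨ cong (λ u → S m + u) (/-*-/ n m 1) ⟩
      S m + + (n ℕ.* 1) / suc m
        ≡⟨ cong (λ a → S m + + a / suc m) (ℕₚ.*-identityʳ n) ⟩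
      S m + + n / suc m ∎
      where
      c = + 1 / suc m

    lower : ∀ m d → S m ≤ S (d ℕ.+ m)
    lower m zero    = ℚₚ.≤-refl
    lower m (suc d) = begin
      S m          ≤⟨ lower m d ⟩
      S j          ≡⟨ ℚₚ.+-identityʳ (S j) ⟨
      S j + 0ℚ     ≤⟨ ℚₚ.+-monoʳ-≤ (S j) (*-nonNeg (0≤z^ (suc j)) (0≤/ 1 j)) ⟩
      S (suc j)    ∎
      where j = d ℕ.+ m

    close′ : ∀ k m d → n ℕ.* suc k ℕ.≤ m → ∣ S (d ℕ.+ m) - S m ∣ ≤ + 1 / suc k
    close′ k m d K≤m = begin
      ∣ S (d ℕ.+ m) - S m ∣      ≡⟨ ℚₚ.0≤p⇒∣p∣≡p (≤⇒0≤- (lower m d)) ⟩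
      S (d ℕ.+ m) - S m          ≤⟨ ℚₚ.+-monoˡ-≤ (- S m) (upper m d) ⟩
      (S m + + n / suc m) - S m  ≡⟨ cancel (S m) (+ n / suc m) ⟩
      + n / suc m                ≤⟨ /-mono n m 1 k bound ⟩
      + 1 / suc k                ∎
      where
      cancel : ∀ p q → (p + q) - p ≡ q
      cancel = solve 2 (λ p q → (p :+ q) :- p := q) refl
        where open +-*-Solver
      bound : n ℕ.* suc k ℕ.≤ 1 ℕ.* suc m
      bound = subst (n ℕ.* suc k ℕ.≤_) (sym (ℕₚ.*-identityˡ (suc m))) (ℕₚ.m≤n⇒m≤1+n K≤m)

    close : ∀ k m d → n ℕ.* suc k ℕ.≤ m → m ℕ.≤ d → ∣ S d - S m ∣ ≤ + 1 / suc k
    close k m d K≤m m≤d = subst (λ e → ∣ S e - S m ∣ ≤ + 1 / suc k)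
      (ℕₚ.m∸n+n≡m m≤d) (close′ k m (d ℕ.∸ m) K≤m)

    flip : ∀ p q → ∣ p - q ∣ ≡ ∣ q - p ∣
    flip p q = trans (cong ∣_∣ (neg p q)) (ℚₚ.∣-p∣≡∣p∣ (q - p))
      where
      neg : ∀ p q → p - q ≡ - (q - p)
      neg = solve 2 (λ p q → p :- q := :- (q :- p)) refl
        where open +-*-Solver

    isCauchy : ∀ k → ∃ λ K → ∀ m d → K ℕ.≤ m → K ℕ.≤ d → ∣ S m - S d ∣ ≤ + 1 / suc k
    isCauchy k = n ℕ.* suc k , λ m d K≤m K≤d → helper m d K≤m K≤d
      where
      helper : ∀ m d → n ℕ.* suc k ℕ.≤ m → n ℕ.* suc k ℕ.≤ d → ∣ S m - S d ∣ ≤ + 1 / suc k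
      helper m d K≤m K≤d with ℕₚ.≤-total m d
      ... | inj₁ m≤d = subst (_≤ + 1 / suc k) (flip (S d) (S m)) (close k m d K≤m m≤d)
      ... | inj₂ d≤m = close k d m K≤d d≤m

log : (n : ℕ) .{{_ : NonZero n}} → ℝ
log n       .seq    = logSeq n
log (suc n) .cauchy = LogCauchy.isCauchy n

π : ℕ → ℕ
π N = length (filter prime? (upTo (suc N)))

_≡_[mod_] : ℕ → ℕ → ℕ → Set
x ≡ y [mod p ] = p ∣ ℕ.∣ x - y ∣

-- A subset of {1, …, n} is given by a `Subset n`, the index i : Fin n standing
-- for the integer i + 1.
⟦_⟧ : ∀ {n} → Fin n → ℕ
⟦ i ⟧ = suc (toℕ i)

module _ {n : ℕ} (X : Subset n) (N : ℕ) where

  IsSolution : Fin n × Fin n × ℕ → Set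
  IsSolution (x , y , p) =
    x ∈ X × y ∈ X × p ℕ.≤ N × Prime p × ⟦ x ⟧ ≡ ⟦ y ⟧ [mod p ]

  isSolution? : ∀ t → Dec (IsSolution t)
  isSolution? (x , y , p) =
    x ∈? X ×-dec y ∈? X ×-dec p ℕₚ.≤? N ×-dec prime? p ×-dec p ∣? ℕ.∣ ⟦ x ⟧ - ⟦ y ⟧ ∣

  𝒥 : ℕ
  𝒥 = length (filter isSolution?
        (cartesianProduct (allFin n) (cartesianProduct (allFin n) (upTo (suc N)))))

{-# OPTIONS --safe #-}
-- A pair x ≠ y in X contributes the prime divisors p ≤ N of d = |x − y| < 10^M,
-- and each x = y ∈ X contributes π(N), so it suffices that d has O(M / log M)
-- distinct prime factors.  Take h with 4^h ≤ M ≤ 4^(h+1).  At most 2^h of the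
-- prime factors are below 2^h.  If r of them are at least 2^h, then
-- (2^h)^r ≤ d < 2^(4M), so h r ≤ 4M.  As h 2^h ≤ 4^h ≤ M, in total d has at
-- most 5M / h prime factors.  Finally log M ≤ 6h, because Mercator's series is
-- dominated by the harmonic series, whose sum up to 2^j is at most j + 1.
module Submission where

open import Defs
open import Data.Fin.Subset using (Subset; ∣_∣)
open import Data.Nat.Base using (ℕ; _*_; _^_; _≤_; NonZero; ∣_-_∣)
open import Data.Product.Base using (∃)

import Algebra.Definitions.RawSemiring
import Algebra.Properties.Semiring.Sum
open import Data.Fin.Base using (Fin; zero; suc)
open import Data.Fin.Properties using (toℕ<n; toℕ-injective)
open import Data.Fin.Subset using (inside; outside; _∈_; _∉_)
open import Data.Fin.Subset.Properties using (drop-there)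
open import Data.Integer.Base as ℤ using ()
import Data.Integer.Properties as ℤₚ
open import Data.List.Base using (List; []; _∷_; _++_; length; map; filter; upTo; applyUpTo; tabulate; cartesianProduct)
open import Data.List.Properties using (length-++; filter-++; filter-none; filter-accept; filter-reject; length-filter; length-upTo)
open import Data.List.Relation.Unary.All as All using (All; []; _∷_)
import Data.List.Relation.Unary.All.Properties as Allₚ
open import Data.List.Relation.Unary.AllPairs using ([]; _∷_)
open import Data.List.Relation.Unary.Unique.Propositional using (Unique)
import Data.List.Relation.Unary.Unique.Propositional.Properties as Uniqueₚ
open import Data.Nat.Base using (zero; suc; _+_; _⊓_; _∸_; z≤n; s≤s; _/_; ≢-nonZero)
open import Data.Nat.Divisibility using (_∣_; divides; ∣⇒≤; _∣0; 1∣_; *-monoˡ-∣)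
open import Data.Nat.DivMod using (m/n*n≤m; m*n/n≡m; /-monoˡ-≤)
open import Data.Nat.ListAction using (product)
open import Data.Nat.Primality using (Prime; prime?; euclidsLemma)
open import Data.Nat.Primality.Factorisation using (factorisationHasAllPrimeFactors)
open import Data.Nat.Properties
open import Data.Nat.Tactic.RingSolver using (solve-∀)
open import Data.Product.Base using (_×_; _,_; proj₁; proj₂)
open import Data.Rational.Base as ℚ using (ℚ; 0ℚ; 1ℚ)
import Data.Rational.Properties as ℚₚ
open import Data.Rational.Solver using (module +-*-Solver)
open import Data.Rational.Unnormalised.Base as ℚᵘ using (mkℚᵘ)
import Data.Rational.Unnormalised.Properties as ℚᵘₚ
open import Data.Sum.Base using (inj₁; inj₂)
open import Data.Vec.Base using ([]; _∷_; here; there)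
open import Function.Base using (_∘_; id)
open import Relation.Binary.PropositionalEquality using (_≡_; _≢_; refl; sym; trans; cong; cong₂; subst; subst₂)
open import Relation.Nullary using (does; yes; no; ¬_; contradiction)
open import Relation.Unary using (Pred; Decidable)
open import Level using (0ℓ)
open import Data.Bool.Base using (true; false)

open Algebra.Properties.Semiring.Sum +-*-semiring using () renaming (sum to ∑)

-- Sums over Fin n

term≤∑ : ∀ {n} (f : Fin n → ℕ) i → f i ≤ ∑ f
term≤∑ f zero    = m≤m+n (f zero) _
term≤∑ f (suc i) = ≤-trans (term≤∑ (f ∘ suc) i) (m≤n+m _ (f zero))

∑-mono-≤ : ∀ {n} (f g : Fin n → ℕ) → (∀ i → f i ≤ g i) → ∑ f ≤ ∑ g
∑-mono-≤ {zero}  f g f≤g = z≤n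
∑-mono-≤ {suc n} f g f≤g = +-mono-≤ (f≤g zero) (∑-mono-≤ (f ∘ suc) (g ∘ suc) (f≤g ∘ suc))

-- Singles out the diagonal term, which equals π(N) and obeys no off-diagonal bound. The whole of
-- `∑ g` stays on the right, including the term at `i`, so nothing has to be removed from a sum.
∑-mono-≤-except : ∀ {n} (f g : Fin n → ℕ) i → (∀ j → i ≢ j → f j ≤ g j) → ∑ f ≤ f i + ∑ g
∑-mono-≤-except f g zero f≤g = +-monoʳ-≤ (f zero)
  (≤-trans (∑-mono-≤ (f ∘ suc) (g ∘ suc) (λ j → f≤g (suc j) λ ())) (m≤n+m _ (g zero)))
∑-mono-≤-except f g (suc i) f≤g = begin
  f zero + ∑ (f ∘ suc)                      ≤⟨ +-mono-≤ (f≤g zero λ ()) (∑-mono-≤-except (f ∘ suc) (g ∘ suc) i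
                                                 λ j i≢j → f≤g (suc j) λ { refl → i≢j refl }) ⟩
  g zero + (f (suc i) + ∑ (g ∘ suc))        ≡⟨ swap (g zero) (f (suc i)) (∑ (g ∘ suc)) ⟩
  f (suc i) + (g zero + ∑ (g ∘ suc))        ∎
  where
  open ≤-Reasoning
  swap : ∀ a b c → a + (b + c) ≡ b + (a + c)
  swap = solve-∀

∑-subset-≤ : ∀ {n} (X : Subset n) (f : Fin n → ℕ) a →
             (∀ {i} → i ∈ X → f i ≤ a) → (∀ {i} → i ∉ X → f i ≤ 0) → ∑ f ≤ ∣ X ∣ * a
∑-subset-≤ []            f a f≤a f≤0 = z≤n
∑-subset-≤ (inside  ∷ X) f a f≤a f≤0 =
  +-mono-≤ (f≤a here) (∑-subset-≤ X (f ∘ suc) a (f≤a ∘ there) (λ i∉X → f≤0 (i∉X ∘ drop-there)))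
∑-subset-≤ (outside ∷ X) f a f≤a f≤0 =
  +-mono-≤ (f≤0 λ ()) (∑-subset-≤ X (f ∘ suc) a (f≤a ∘ there) (λ i∉X → f≤0 (i∉X ∘ drop-there)))

∑-subset-≥ : ∀ {n} (X : Subset n) (f : Fin n → ℕ) a →
             (∀ {i} → i ∈ X → a ≤ f i) → ∣ X ∣ * a ≤ ∑ f
∑-subset-≥ []            f a a≤f = z≤n
∑-subset-≥ (inside  ∷ X) f a a≤f = +-mono-≤ (a≤f here) (∑-subset-≥ X (f ∘ suc) a (a≤f ∘ there))
∑-subset-≥ (outside ∷ X) f a a≤f =
  ≤-trans (∑-subset-≥ X (f ∘ suc) a (a≤f ∘ there)) (m≤n+m _ (f zero))

-- Counting by filtering

count : ∀ {A : Set} {P : Pred A 0ℓ} → Decidable P → List A → ℕ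
count P? xs = length (filter P? xs)

count-++ : ∀ {A : Set} {P : Pred A 0ℓ} (P? : Decidable P) xs ys →
           count P? (xs ++ ys) ≡ count P? xs + count P? ys
count-++ P? xs ys = trans (cong length (filter-++ P? xs ys)) (length-++ (filter P? xs))

count-map : ∀ {A B : Set} {P : Pred B 0ℓ} (P? : Decidable P) (f : A → B) xs →
            count P? (map f xs) ≡ count (P? ∘ f) xs
count-map P? f []       = refl
count-map P? f (x ∷ xs) with does (P? (f x))
... | true  = cong suc (count-map P? f xs)
... | false = count-map P? f xs

-- The equivalence is asked for only at members of the list, so that p ≤ N may be read off from
-- membership in `upTo (suc N)`.
count-cong : ∀ {A : Set} {P Q : Pred A 0ℓ} (P? : Decidable P) (Q? : Decidable Q) {xs} →
             All (λ x → (P x → Q x) × (Q x → P x)) xs → count P? xs ≡ count Q? xs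
count-cong P? Q? [] = refl
count-cong P? Q? {x ∷ xs} ((P⇒Q , Q⇒P) ∷ rest) with P? x
... | yes p = trans (cong suc (count-cong P? Q? rest)) (cong length (sym (filter-accept Q? (P⇒Q p))))
... | no ¬p = trans (count-cong P? Q? rest) (cong length (sym (filter-reject Q? (¬p ∘ Q⇒P))))

-- The first factor is a general `tabulate g` so that the induction can pass to `g ∘ suc`;
-- `allFin n` is the case `g = id`.
count-cartesianProduct : ∀ {A B : Set} {P : Pred (A × B) 0ℓ} (P? : Decidable P) {n} (g : Fin n → A) ys →
  count P? (cartesianProduct (tabulate g) ys) ≡ ∑ (λ i → count (λ y → P? (g i , y)) ys)
count-cartesianProduct P? {zero}  g ys = refl
count-cartesianProduct P? {suc n} g ys = trans
  (count-++ P? (map (g zero ,_) ys) _)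
  (cong₂ _+_ (count-map P? (g zero ,_) ys) (count-cartesianProduct P? (g ∘ suc) ys))

applyUpTo-+ : ∀ {A : Set} (f : ℕ → A) m n →
              applyUpTo f (m + n) ≡ applyUpTo f m ++ applyUpTo (λ i → f (m + i)) n
applyUpTo-+ f zero    n = refl
applyUpTo-+ f (suc m) n = cong (f 0 ∷_) (applyUpTo-+ (f ∘ suc) m n)

-- Prime divisors

-- Induction on the list: write d = q · `product ps`. By Euclid's lemma p divides q or `product ps`;
-- in the second case p would be one of the primes in `ps`, against distinctness.
product-distinct-primes-∣ : ∀ {d ps} → Unique ps → All Prime ps → All (_∣ d) ps → product ps ∣ d
product-distinct-primes-∣ {d} [] [] [] = 1∣ d
product-distinct-primes-∣ {d} {p ∷ ps} (p∉ps ∷ distinct) (prime[p] ∷ primes) (p∣d ∷ ps∣d)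
  with product-distinct-primes-∣ distinct primes ps∣d
... | divides q refl with euclidsLemma q (product ps) prime[p] p∣d
...   | inj₁ p∣q  = *-monoˡ-∣ (product ps) p∣q
...   | inj₂ p∣ps = contradiction refl
        (All.lookup p∉ps (factorisationHasAllPrimeFactors prime[p] p∣ps primes))

^-length≤product : ∀ B {ps} → All (B ≤_) ps → B ^ length ps ≤ product ps
^-length≤product B []           = ≤-refl
^-length≤product B (B≤p ∷ B≤ps) = *-mono-≤ B≤p (^-length≤product B B≤ps)

2^-cancel-≤ : ∀ m n → 2 ^ m ≤ 2 ^ n → m ≤ n
2^-cancel-≤ m n 2^m≤2^n with m ≤? n
... | yes m≤n = m≤n
... | no  m≰n = contradiction (^-monoʳ-< 2 (s≤s (s≤s z≤n)) (≰⇒> m≰n)) (≤⇒≯ 2^m≤2^n)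

n≤2^n : ∀ n → n ≤ 2 ^ n
n≤2^n zero    = z≤n
n≤2^n (suc n) = +-mono-≤ (m^n>0 2 n) (≤-trans (n≤2^n n) (m≤m+n _ 0))

-- Because 10 ≤ 16 = 2^4.
10^n≤2^[4n] : ∀ n → 10 ^ n ≤ 2 ^ (4 * n)
10^n≤2^[4n] n = subst (10 ^ n ≤_) (^-*-assoc 2 4 n) (^-monoˡ-≤ n (m≤m+n 10 6))

-- `P` may be stronger than being a prime divisor of d, so `isSolution?` at a fixed pair (x, y) can
-- be used as it stands.
module _ {d M h : ℕ} .{{_ : NonZero d}} (d≤10^M : d ≤ 10 ^ M) (4^h≤M : 4 ^ h ≤ M)
         {P : Pred ℕ 0ℓ} (P? : Decidable P) (P⇒primeDivisor : ∀ {p} → P p → Prime p × p ∣ d) where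

  private B = 2 ^ h

  -- Listing the candidates as B + i makes each of them at least 2^h by construction. The estimate
  -- is then a comparison of exponents of 2.
  count-large-primeDivisors : ∀ n → h * count P? (applyUpTo (B +_) n) ≤ 4 * M
  count-large-primeDivisors n = 2^-cancel-≤ _ _ (begin
    2 ^ (h * length ps)  ≡⟨ ^-*-assoc 2 h (length ps) ⟨
    B ^ length ps        ≤⟨ ^-length≤product B (Allₚ.filter⁺ P? (Allₚ.applyUpTo⁺₂ (B +_) n (m≤m+n B))) ⟩
    product ps           ≤⟨ ∣⇒≤ (product-distinct-primes-∣ distinct
                              (All.map (proj₁ ∘ P⇒primeDivisor) all-P) (All.map (proj₂ ∘ P⇒primeDivisor) all-P)) ⟩
    d                    ≤⟨ d≤10^M ⟩
    10 ^ M               ≤⟨ 10^n≤2^[4n] M ⟩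
    2 ^ (4 * M)          ∎)
    where
    open ≤-Reasoning
    ps = filter P? (applyUpTo (B +_) n)
    all-P : All P ps
    all-P = Allₚ.all-filter P? (applyUpTo (B +_) n)
    distinct : Unique ps
    distinct = Uniqueₚ.filter⁺ P? (Uniqueₚ.applyUpTo⁺₁ (B +_) n (λ i<j _ → <⇒≢ (+-monoʳ-< B i<j)))

  h*2^h≤M : h * B ≤ M
  h*2^h≤M = begin
    h * B        ≤⟨ *-monoˡ-≤ B (n≤2^n h) ⟩
    B * B        ≡⟨ ^-distribˡ-+-* 2 h h ⟨
    2 ^ (h + h)  ≡⟨ cong (2 ^_) (double h) ⟩
    2 ^ (2 * h)  ≡⟨ ^-*-assoc 2 2 h ⟨
    4 ^ h        ≤⟨ 4^h≤M ⟩
    M            ∎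
    where
    open ≤-Reasoning
    double : ∀ h → h + h ≡ 2 * h
    double = solve-∀

  count-primeDivisors : ∀ n → h * count P? (upTo n) ≤ 5 * M
  count-primeDivisors n with ≤-total n B
  ... | inj₁ n≤B = begin
    h * count P? (upTo n)  ≤⟨ *-monoʳ-≤ h (≤-trans (length-filter P? (upTo n)) (≤-reflexive (length-upTo n))) ⟩
    h * n                  ≤⟨ *-monoʳ-≤ h n≤B ⟩
    h * B                  ≤⟨ h*2^h≤M ⟩
    M                      ≤⟨ m≤m+n M (4 * M) ⟩
    5 * M                  ∎
    where open ≤-Reasoning
  ... | inj₂ B≤n = begin
    h * count P? (upTo n)                       ≡⟨ cong (λ k → h * count P? (upTo k)) (m+[n∸m]≡n B≤n) ⟨
    h * count P? (upTo (B + m))                 ≡⟨ cong (λ xs → h * count P? xs) (applyUpTo-+ id B m) ⟩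
    h * count P? (upTo B ++ large)              ≡⟨ cong (h *_) (count-++ P? (upTo B) large) ⟩
    h * (count P? (upTo B) + count P? large)    ≡⟨ *-distribˡ-+ h _ _ ⟩
    -- Below `B` the number of candidates bounds the count.
    h * count P? (upTo B) + h * count P? large  ≤⟨ +-mono-≤ (*-monoʳ-≤ h (≤-trans (length-filter P? (upTo B)) (≤-reflexive (length-upTo B))))
                                                            (count-large-primeDivisors m) ⟩
    h * B + 4 * M                               ≤⟨ +-monoˡ-≤ (4 * M) h*2^h≤M ⟩
    5 * M                                       ∎
    where
    open ≤-Reasoning
    m = n ∸ B
    large = applyUpTo (B +_) m

-- Counting the solutions

module _ {n : ℕ} (X : Subset n) (N W : ℕ) where

  private
    #p : Fin n → Fin n → ℕ
    #p x y = count (λ p → isSolution? X N (x , y , p)) (upTo (suc N))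

    #yp : Fin n → ℕ
    #yp x = ∑ (#p x)

  𝒥≡∑∑ : 𝒥 X N ≡ ∑ #yp
  𝒥≡∑∑ = trans (count-cartesianProduct (isSolution? X N) id _) (∑-cong λ x →
    count-cartesianProduct (λ yp → isSolution? X N (x , yp)) id (upTo (suc N)))
    where open Algebra.Properties.Semiring.Sum +-*-semiring using () renaming (sum-cong-≗ to ∑-cong)

  diagonal : ∀ {x} → x ∈ X → #p x x ≡ π N
  diagonal {x} x∈X = count-cong (λ p → isSolution? X N (x , x , p)) prime?
    (All.map (λ p<1+N → (λ (_ , _ , _ , prime[p] , _) → prime[p])
                      , (λ prime[p] → x∈X , x∈X , ≤-pred p<1+N , prime[p]
                                    , subst (_ ∣_) (sym (∣n-n∣≡0 ⟦ x ⟧)) (_ ∣0)))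
             (Allₚ.all-upTo (suc N)))

  #p≡0 : ∀ x y → ¬ (x ∈ X × y ∈ X) → #p x y ≡ 0
  #p≡0 x y ∉ = cong length (filter-none (λ p → isSolution? X N (x , y , p))
    (All.universal (λ _ (x∈X , y∈X , _) → ∉ (x∈X , y∈X)) (upTo (suc N))))

  -- The bound `W` per off-diagonal pair stays abstract here; it becomes the integer quotient of 5M
  -- by h.
  module _ (offDiagonal : ∀ {x y} → x ≢ y → #p x y ≤ W) where

    #yp≤ : ∀ {x} → x ∈ X → #yp x ≤ π N + ∣ X ∣ * W
    #yp≤ {x} x∈X = begin
      -- Truncation at `W` caps the diagonal term still present in the second sum, and keeps the
      -- summand zero for y outside X.
      ∑ (#p x)                       ≤⟨ ∑-mono-≤-except (#p x) (λ y → #p x y ⊓ W) x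
                                          (λ y x≢y → ⊓-glb ≤-refl (offDiagonal x≢y)) ⟩
      #p x x + ∑ (λ y → #p x y ⊓ W)  ≤⟨ +-mono-≤ (≤-reflexive (diagonal x∈X))
                                          (∑-subset-≤ X (λ y → #p x y ⊓ W) W (λ {y} _ → m⊓n≤n (#p x y) W)
                                            (λ {y} y∉X → ≤-trans (m⊓n≤m (#p x y) W) (≤-reflexive (#p≡0 x y (y∉X ∘ proj₂))))) ⟩
      π N + ∣ X ∣ * W                ∎
      where open ≤-Reasoning

    #yp≤0 : ∀ {x} → x ∉ X → #yp x ≤ 0
    #yp≤0 {x} x∉X = ≤-trans
      (∑-subset-≤ X (#p x) 0 (λ {y} _ → ≤-reflexive (#p≡0 x y (x∉X ∘ proj₁))) (λ {y} _ → ≤-reflexive (#p≡0 x y (x∉X ∘ proj₁))))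
      (≤-reflexive (*-zeroʳ ∣ X ∣))

    -- Each x ∈ X contributes at least π(N) and at most π(N) + |X| W. Hence the error is one-sided,
    -- and the absolute difference is a truncated subtraction.
    𝒥-approx : ∣ 𝒥 X N - π N * ∣ X ∣ ∣ ≤ ∣ X ∣ ^ 2 * W
    𝒥-approx = begin
      ∣ 𝒥 X N - π N * ∣ X ∣ ∣                       ≡⟨ cong₂ ∣_-_∣ 𝒥≡∑∑ (*-comm (π N) ∣ X ∣) ⟩
      ∣ ∑ #yp - main ∣                              ≡⟨ m≤n⇒∣n-m∣≡n∸m main≤ ⟩
      ∑ #yp ∸ main                    ≤⟨ ∸-monoˡ-≤ main (∑-subset-≤ X #yp _ #yp≤ #yp≤0) ⟩
      ∣ X ∣ * (π N + ∣ X ∣ * W) ∸ main ≡⟨ cong (_∸ main) (expand ∣ X ∣ (π N) W) ⟩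
      main + ∣ X ∣ ^ 2 * W ∸ main     ≡⟨ m+n∸m≡n main _ ⟩
      ∣ X ∣ ^ 2 * W                                 ∎
      where
      open ≤-Reasoning
      main = ∣ X ∣ * π N
      main≤ : main ≤ ∑ #yp
      main≤ = ∑-subset-≥ X #yp (π N) λ {x} x∈X →
        ≤-trans (≤-reflexive (sym (diagonal x∈X))) (term≤∑ (#p x) x)
      expand : ∀ a b w → a * (b + a * w) ≡ a * b + a * (a * 1) * w
      expand = solve-∀

-- The logarithm

/-mono-≤ : ∀ a b c d → a * suc d ≤ c * suc b → ℤ.+ a ℚ./ suc b ℚ.≤ ℤ.+ c ℚ./ suc d
/-mono-≤ a b c d ad≤cb = ℚₚ.toℚᵘ-cancel-≤ (begin
  ℚ.toℚᵘ (ℤ.+ a ℚ./ suc b)  ≃⟨ ℚₚ.toℚᵘ-fromℚᵘ (mkℚᵘ (ℤ.+ a) b) ⟩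
  mkℚᵘ (ℤ.+ a) b            ≤⟨ ℚᵘ.*≤* (subst₂ ℤ._≤_ (ℤₚ.pos-* a (suc d)) (ℤₚ.pos-* c (suc b)) (ℤ.+≤+ ad≤cb)) ⟩
  mkℚᵘ (ℤ.+ c) d            ≃⟨ ℚₚ.toℚᵘ-fromℚᵘ (mkℚᵘ (ℤ.+ c) d) ⟨
  ℚ.toℚᵘ (ℤ.+ c ℚ./ suc d)  ∎)
  where open ℚᵘₚ.≤-Reasoning

0≤/ : ∀ a b → 0ℚ ℚ.≤ ℤ.+ a ℚ./ suc b
0≤/ a b = /-mono-≤ 0 0 a b z≤n

-- By definition the constant term of `fromℕ a`, and the factor applied termwise in `a · x`.
ι : ℕ → ℚ
ι a = ℤ.+ a ℚ./ 1

ι-mono-≤ : ∀ {a b} → a ≤ b → ι a ℚ.≤ ι b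
ι-mono-≤ {a} {b} a≤b = /-mono-≤ a 0 b 0 (*-monoˡ-≤ 1 a≤b)

ι-+ : ∀ a b → ι (a + b) ≡ ι a ℚ.+ ι b
ι-+ a b = ℚₚ.toℚᵘ-injective (begin
  ℚ.toℚᵘ (ι (a + b))               ≈⟨ ℚₚ.toℚᵘ-fromℚᵘ (mkℚᵘ (ℤ.+ (a + b)) 0) ⟩
  mkℚᵘ (ℤ.+ (a + b)) 0               ≈⟨ ℚᵘ.*≡* (cong (ℤ._* ℤ.+ 1) (cong₂ ℤ._+_ (sym (ℤₚ.*-identityʳ (ℤ.+ a))) (sym (ℤₚ.*-identityʳ (ℤ.+ b))))) ⟩
  mkℚᵘ (ℤ.+ a) 0 ℚᵘ.+ mkℚᵘ (ℤ.+ b) 0   ≈⟨ ℚᵘₚ.+-cong (ℚₚ.toℚᵘ-fromℚᵘ (mkℚᵘ (ℤ.+ a) 0)) (ℚₚ.toℚᵘ-fromℚᵘ (mkℚᵘ (ℤ.+ b) 0)) ⟨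
  ℚ.toℚᵘ (ι a) ℚᵘ.+ ℚ.toℚᵘ (ι b)   ≈⟨ ℚₚ.toℚᵘ-homo-+ (ι a) (ι b) ⟨
  ℚ.toℚᵘ (ι a ℚ.+ ι b)             ∎)
  where open import Relation.Binary.Reasoning.Setoid ℚᵘₚ.≃-setoid

ι-*-/ : ∀ a b c → ι a ℚ.* (ℤ.+ c ℚ./ suc b) ≡ ℤ.+ (a * c) ℚ./ suc b
ι-*-/ a b c = ℚₚ.toℚᵘ-injective (begin
  ℚ.toℚᵘ (ι a ℚ.* (ℤ.+ c ℚ./ suc b))           ≈⟨ ℚₚ.toℚᵘ-homo-* (ι a) (ℤ.+ c ℚ./ suc b) ⟩
  ℚ.toℚᵘ (ι a) ℚᵘ.* ℚ.toℚᵘ (ℤ.+ c ℚ./ suc b)   ≈⟨ ℚᵘₚ.*-cong (ℚₚ.toℚᵘ-fromℚᵘ (mkℚᵘ (ℤ.+ a) 0)) (ℚₚ.toℚᵘ-fromℚᵘ (mkℚᵘ (ℤ.+ c) b)) ⟩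
  mkℚᵘ (ℤ.+ a) 0 ℚᵘ.* mkℚᵘ (ℤ.+ c) b             ≈⟨ ℚᵘ.*≡* (cong₂ ℤ._*_ (sym (ℤₚ.pos-* a c)) (cong ℤ.+_ (sym (+-identityʳ (suc b))))) ⟩
  mkℚᵘ (ℤ.+ (a * c)) b                         ≈⟨ ℚₚ.toℚᵘ-fromℚᵘ (mkℚᵘ (ℤ.+ (a * c)) b) ⟨
  ℚ.toℚᵘ (ℤ.+ (a * c) ℚ./ suc b)               ∎)
  where open import Relation.Binary.Reasoning.Setoid ℚᵘₚ.≃-setoid

∑<-block : ∀ (f : ℕ → ℚ) c m d → (∀ k → m ≤ k → f k ℚ.≤ c) → ∑< (d + m) f ℚ.≤ ∑< m f ℚ.+ ι d ℚ.* c
∑<-block f c m zero    f≤c = ℚₚ.≤-reflexive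
  (sym (trans (cong (∑< m f ℚ.+_) (ℚₚ.*-zeroˡ c)) (ℚₚ.+-identityʳ (∑< m f))))
∑<-block f c m (suc d) f≤c = begin
  ∑< (d + m) f ℚ.+ f (d + m)             ≤⟨ ℚₚ.+-mono-≤ (∑<-block f c m d f≤c) (f≤c (d + m) (m≤n+m m d)) ⟩
  (∑< m f ℚ.+ ι d ℚ.* c) ℚ.+ c           ≡⟨ collect (∑< m f) (ι d) c ⟩
  ∑< m f ℚ.+ (1ℚ ℚ.+ ι d) ℚ.* c          ≡⟨ cong (λ u → ∑< m f ℚ.+ u ℚ.* c) (ι-+ 1 d) ⟨
  ∑< m f ℚ.+ ι (suc d) ℚ.* c             ∎
  where
  open ℚₚ.≤-Reasoning
  collect : ∀ s u c → (s ℚ.+ u ℚ.* c) ℚ.+ c ≡ s ℚ.+ (1ℚ ℚ.+ u) ℚ.* c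
  collect = solve 3 (λ s u c → (s :+ u :* c) :+ c := s :+ (con 1ℚ :+ u) :* c) refl
    where open +-*-Solver

-- Passing from m = 2^j to 2m terms adds m terms, each at most 1/(m + 1), hence at most 1 in total.
-- The first term is also at most 1.
harmonic-dyadic : ∀ (f : ℕ → ℚ) → (∀ k → f k ℚ.≤ ℤ.+ 1 ℚ./ suc k) → ∀ j → ∑< (2 ^ j) f ℚ.≤ ι (suc j)
harmonic-dyadic f f≤ zero    = ℚₚ.≤-trans (ℚₚ.≤-reflexive (ℚₚ.+-identityˡ (f 0))) (f≤ 0)
harmonic-dyadic f f≤ (suc j) = begin
  ∑< (2 ^ suc j) f                        ≡⟨ cong (λ k → ∑< (m + k) f) (+-identityʳ m) ⟩
  ∑< (m + m) f                            ≤⟨ ∑<-block f (ℤ.+ 1 ℚ./ suc m) m m (λ k m≤k →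
                                               ℚₚ.≤-trans (f≤ k) (/-mono-≤ 1 k 1 m (*-monoʳ-≤ 1 (s≤s m≤k)))) ⟩
  ∑< m f ℚ.+ ι m ℚ.* (ℤ.+ 1 ℚ./ suc m)      ≡⟨ cong (∑< m f ℚ.+_) (ι-*-/ m m 1) ⟩
  ∑< m f ℚ.+ ℤ.+ (m * 1) ℚ./ suc m          ≤⟨ ℚₚ.+-mono-≤ (harmonic-dyadic f f≤ j) (/-mono-≤ (m * 1) m 1 0 m≤1+m) ⟩
  ι (suc j) ℚ.+ ι 1                       ≡⟨ ℚₚ.+-comm (ι (suc j)) (ι 1) ⟩
  ι 1 ℚ.+ ι (suc j)                       ≡⟨ ι-+ 1 (suc j) ⟨
  ι (suc (suc j))                         ∎
  where
  open ℚₚ.≤-Reasoning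
  m = 2 ^ j
  m≤1+m : m * 1 * 1 ≤ 1 * suc m
  m≤1+m = subst₂ _≤_ (sym (trans (*-identityʳ (m * 1)) (*-identityʳ m))) (sym (*-identityˡ (suc m))) (n≤1+n m)

open Algebra.Definitions.RawSemiring ℚ.+-*-rawSemiring using () renaming (_^_ to _^ℚ_)

^-≤1 : ∀ {z} → 0ℚ ℚ.≤ z → z ℚ.≤ 1ℚ → ∀ k → z ^ℚ k ℚ.≤ 1ℚ
^-≤1     0≤z z≤1 zero    = ℚₚ.≤-refl
^-≤1 {z} 0≤z z≤1 (suc k) = begin
  z ℚ.* z ^ℚ k  ≤⟨ ℚₚ.*-monoˡ-≤-nonNeg z {{ℚ.nonNegative 0≤z}} (^-≤1 0≤z z≤1 k) ⟩
  z ℚ.* 1ℚ      ≡⟨ ℚₚ.*-identityʳ z ⟩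
  z             ≤⟨ z≤1 ⟩
  1ℚ            ∎
  where open ℚₚ.≤-Reasoning

-- The base 1 - 1/(n + 1) lies in [0, 1], so its powers are at most 1 and the harmonic term remains.
logTerm≤ : ∀ n k → (1ℚ ℚ.- ℤ.+ 1 ℚ./ suc n) ^ℚ suc k ℚ.* (ℤ.+ 1 ℚ./ suc k) ℚ.≤ ℤ.+ 1 ℚ./ suc k
logTerm≤ n k = begin
  z ^ℚ suc k ℚ.* c  ≤⟨ ℚₚ.*-monoʳ-≤-nonNeg c {{ℚ.nonNegative (0≤/ 1 k)}} (^-≤1 0≤z z≤1 (suc k)) ⟩
  1ℚ ℚ.* c          ≡⟨ ℚₚ.*-identityˡ c ⟩
  c                 ∎
  where
  open ℚₚ.≤-Reasoning
  i = ℤ.+ 1 ℚ./ suc n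
  z = 1ℚ ℚ.- i
  c = ℤ.+ 1 ℚ./ suc k
  0≤z : 0ℚ ℚ.≤ z
  0≤z = subst (ℚ._≤ z) (ℚₚ.+-inverseʳ i) (ℚₚ.+-monoˡ-≤ (ℚ.- i) (/-mono-≤ 1 n 1 0 (s≤s z≤n)))
  z≤1 : z ℚ.≤ 1ℚ
  z≤1 = subst (z ℚ.≤_) (ℚₚ.+-identityʳ 1ℚ) (ℚₚ.+-monoʳ-≤ 1ℚ (ℚₚ.neg-antimono-≤ (0≤/ 1 n)))

p≤∣p∣ : ∀ p → p ℚ.≤ ℚ.∣ p ∣
p≤∣p∣ p with ℚₚ.≤-total 0ℚ p
... | inj₁ 0≤p = ℚₚ.≤-reflexive (sym (ℚₚ.0≤p⇒∣p∣≡p 0≤p))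
... | inj₂ p≤0 = ℚₚ.≤-trans p≤0 (ℚₚ.0≤∣p∣ p)

-- At precision 1 the modulus of convergence of `log n` is n itself, so 2^j ≥ n
-- terms of the series already determine the limit up to 1.
logSeq-≤ : ∀ n j k → suc n ≤ 2 ^ j → 2 ^ j ≤ k → logSeq (suc n) k ℚ.≤ ι (2 + j)
logSeq-≤ n j k n<2^j 2^j≤k = begin
  S k                              ≡⟨ split (S k) (S m) ⟩
  (S k ℚ.- S m) ℚ.+ S m            ≤⟨ ℚₚ.+-mono-≤ (ℚₚ.≤-trans (p≤∣p∣ (S k ℚ.- S m)) close)
                                        (harmonic-dyadic _ (logTerm≤ n) j) ⟩
  ι 1 ℚ.+ ι (suc j)                ≡⟨ ι-+ 1 (suc j) ⟨
  ι (2 + j)                        ∎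
  where
  open ℚₚ.≤-Reasoning
  S = logSeq (suc n)
  m = 2 ^ j
  K≤m : suc n * 1 ≤ m
  K≤m = subst (_≤ m) (sym (*-identityʳ (suc n))) n<2^j
  close : ℚ.∣ S k ℚ.- S m ∣ ℚ.≤ ι 1
  close = proj₂ (cauchy (log (suc n)) 0) k m (≤-trans K≤m 2^j≤k) K≤m
  split : ∀ p q → p ≡ (p ℚ.- q) ℚ.+ q
  split = solve 2 (λ p q → p := (p :- q) :+ q) refl
    where open +-*-Solver

-- Turns the inequality between reals into one between natural numbers, through log n ≤ 2 + j for n
-- ≤ 2^j.
·-log-≤ : ∀ a n .{{_ : NonZero n}} j b → n ≤ 2 ^ j → a * (2 + j) ≤ b → a · log n ≤ᴿ fromℕ b
-- The index 2^j serves every precision k, since from there on the partial sums satisfy the bound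
-- exactly.
·-log-≤ a (suc n) j b n<2^j a[2+j]≤b k = 2 ^ j , λ i 2^j≤i → begin
  ι a ℚ.* logSeq (suc n) i   ≤⟨ ℚₚ.*-monoˡ-≤-nonNeg (ι a) {{ℚ.nonNegative (0≤/ a 0)}} (logSeq-≤ n j i n<2^j 2^j≤i) ⟩
  ι a ℚ.* ι (2 + j)          ≡⟨ ι-*-/ a 0 (2 + j) ⟩
  ι (a * (2 + j))            ≤⟨ ι-mono-≤ a[2+j]≤b ⟩
  ι b                        ≡⟨ ℚₚ.+-identityʳ (ι b) ⟨
  ι b ℚ.+ 0ℚ                 ≤⟨ ℚₚ.+-monoʳ-≤ (ι b) (0≤/ 1 k) ⟩
  ι b ℚ.+ ℤ.+ 1 ℚ./ suc k      ∎
  where open ℚₚ.≤-Reasoning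

-- Choice of h and the final estimate

-- Induction on M; the exponent grows only when M reaches the upper end 4^(2 + h). Writing the lower
-- exponent as `suc h` records that it is positive, which permits division by it.
log₄ : ∀ M → 4 ≤ M → ∃ λ h → 4 ^ suc h ≤ M × M ≤ 4 ^ (2 + h)
log₄ (suc M) 4≤1+M with m≤n⇒m<n∨m≡n 4≤1+M
... | inj₂ refl = 0 , ≤-refl , m≤m+n 4 12
... | inj₁ (s≤s 4≤M) with log₄ M 4≤M
...   | h , lower , upper with m≤n⇒m<n∨m≡n upper
...     | inj₁ M<     = h , m≤n⇒m≤1+n lower , M<
...     | inj₂ refl   = suc h , n≤1+n _ , ≤-trans (m<m*n M 4 {{m^n≢0 4 (2 + h)}} (s≤s (s≤s z≤n))) (≤-reflexive (*-comm M 4))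

module _ (M h : ℕ) .{{_ : NonZero h}} (4^h≤M : 4 ^ h ≤ M) (X : Subset (10 ^ M)) (N : ℕ) where

  -- `count-primeDivisors` bounds h times the count; integer division by h gives a bound on the
  -- count itself.
  offDiagonal-≤ : ∀ {x y} → x ≢ y → count (λ p → isSolution? X N (x , y , p)) (upTo (suc N)) ≤ 5 * M / h
  offDiagonal-≤ {x} {y} x≢y = begin
    k             ≡⟨ m*n/n≡m k h ⟨
    k * h / h     ≤⟨ /-monoˡ-≤ h (≤-trans (≤-reflexive (*-comm k h))
                       (count-primeDivisors {d} {M} {h} {{≢-nonZero d≢0}} d≤10^M 4^h≤M (λ p → isSolution? X N (x , y , p))
                         (λ (_ , _ , _ , prime[p] , p∣d) → prime[p] , p∣d) (suc N))) ⟩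
    5 * M / h     ∎
    where
    open ≤-Reasoning
    k = count (λ p → isSolution? X N (x , y , p)) (upTo (suc N))
    d = ∣ ⟦ x ⟧ - ⟦ y ⟧ ∣
    -- Distinctness of x and y enters here: zero is divisible by every prime.
    d≢0 : d ≢ 0
    d≢0 d≡0 = x≢y (toℕ-injective (suc-injective (∣m-n∣≡0⇒m≡n d≡0)))
    d≤10^M : d ≤ 10 ^ M
    d≤10^M = ≤-trans (∣m-n∣≤m⊔n ⟦ x ⟧ ⟦ y ⟧) (⊔-lub (toℕ<n x) (toℕ<n y))

  -- The factor 2 + 2(h + 1) is the bound for log M when M ≤ 4^(h + 1). It is at most 6h as h ≥ 1,
  -- and W h ≤ 5M, whence 30 = 6 · 5.
  𝒥-error-≤ : ∣ 𝒥 X N - π N * ∣ X ∣ ∣ * (2 + 2 * suc h) ≤ 30 * (∣ X ∣ ^ 2 * M)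
  𝒥-error-≤ = begin
    ∣ 𝒥 X N - π N * ∣ X ∣ ∣ * (2 + 2 * suc h)  ≤⟨ *-mono-≤ (𝒥-approx X N W offDiagonal-≤) (2h+4≤6h h) ⟩
    ∣ X ∣ ^ 2 * W * (6 * h)                    ≡⟨ regroup (∣ X ∣ ^ 2) W h ⟩
    6 * (∣ X ∣ ^ 2 * (W * h))                  ≤⟨ *-monoʳ-≤ 6 (*-monoʳ-≤ (∣ X ∣ ^ 2) (m/n*n≤m (5 * M) h)) ⟩
    6 * (∣ X ∣ ^ 2 * (5 * M))                  ≡⟨ numeral (∣ X ∣ ^ 2) M ⟩
    30 * (∣ X ∣ ^ 2 * M)                       ∎
    where
    open ≤-Reasoning
    W = 5 * M / h
    regroup : ∀ a w h → a * w * (6 * h) ≡ 6 * (a * (w * h))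
    regroup = solve-∀
    numeral : ∀ a m → 6 * (a * (5 * m)) ≡ 30 * (a * m)
    numeral = solve-∀
    2h+4≤6h : ∀ h .{{_ : NonZero h}} → 2 + 2 * suc h ≤ 6 * h
    2h+4≤6h (suc k) = subst₂ _≤_ (left k) (right k) (m≤m+n (6 + 2 * k) (4 * k))
      where
      left : ∀ k → 6 + 2 * k ≡ 2 + 2 * (2 + k)
      left = solve-∀
      right : ∀ k → 6 + 2 * k + 4 * k ≡ 6 * (1 + k)
      right = solve-∀

-- Multiplying the estimate through by log M avoids a division of reals. The constant is chosen
-- before M, X and N, hence absolute.
theorem1 : ∃ λ (C : ℕ) → ∃ λ (M₀ : ℕ) → ∃ λ (N₀ : ℕ) →
    (M : ℕ) .{{_ : NonZero M}} → M₀ ≤ M →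
    (X : Subset (10 ^ M)) →
    (N : ℕ) → N₀ ≤ N →
    ∣ 𝒥 X N - π N * ∣ X ∣ ∣ · log M ≤ᴿ fromℕ (C * (∣ X ∣ ^ 2 * M))
-- 30 comes from `𝒥-error-≤`, and 4 is the threshold of `log₄`.
theorem1 = 30 , 4 , 0 , λ M 4≤M X N _ →
  let h-1 , 4^h≤M , M≤4^[1+h] = log₄ M 4≤M
      h = suc h-1
  in ·-log-≤ ∣ 𝒥 X N - π N * ∣ X ∣ ∣ M (2 * suc h) (30 * (∣ X ∣ ^ 2 * M))
       -- 4^(1 + h) = 2^(2(1 + h)) supplies the power of 2 above M.
       (subst (M ≤_) (^-*-assoc 2 2 (suc h)) M≤4^[1+h])
       (𝒥-error-≤ M h 4^h≤M X N)
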